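{- Let $\mathfrak S=(S,F,\leq)$ be an $\infty$-effective complete WSTS and $s_0\in S$. If the procedure $\mathbf{Clover}_{\mathfrak S}$ terminates on input $s_0$, then it returns $Clover_{\mathfrak S}(s_0)$.
   Context: Poset notions: ${\downarrow}E$, ${\uparrow}E$ closures; $\mathrm{Max}\,E$ maximal elements; directed set (nonempty, pairwise upper bounds inside); dcpo (all directed sups $\bigvee D$ exist); continuous dcpo (every $x$ is the directed sup of $\{y\mid y\ll x\}$, where $y\ll x$ iff every directed $D$ with $\bigvee D\geq x$ has some $z\in D$ with $y\leq z$); wpo (every infinite sequence has $i<j$ with $x_i\leq x_j$); dcwo = dcpo that is a wpo. Scott-open: upward-closed and meeting every directed $D$ whose sup it contains; $\mathrm{Lub}(E)=\{\bigvee D\mid D\subseteq E\text{ directed}\}$. A complete WSTS is $(S,F,\leq)$ with $(S,\leq)$ a continuous dcwo and $F$ a finite set of partial continuous maps $S\to S$ (Scott-open domain, $f(\bigvee D)=\bigvee f(D)$ for directed $D\subseteq\mathrm{dom} f$). $F^*$: finite compositions. $Post_{\mathfrak S}(A)=\{f(a)\mid f\in F,a\in A\cap\mathrm{dom}f\}$; $Cover_{\mathfrak S}(s_0)={\downarrow}Post^*_{\mathfrak S}({\downarrow}s_0)$; $Clover_{\mathfrak S}(s_0)=\mathrm{Max}\,\mathrm{Lub}(Cover_{\mathfrak S}(s_0))$. Lub-acceleration: $g^\infty$ has domain $\mathrm{dom}\,g$, $g^\infty(x)=\bigvee_n g^n(x)$ if $x<g(x)$, else $g(x)$. $\infty$-effective: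 states have natural-number codes, $\leq$ decidable, each $f\in F$ computable with decidable domain, and $g^\infty$ computable for each $g\in F^*$. Procedure $\mathbf{Clover}_{\mathfrak S}(s_0)$: with $A\leq^\flat B$ iff ${\downarrow}A\subseteq{\downarrow}B$: set $A\leftarrow\{s_0\}$; while $Post_{\mathfrak S}(A)\not\leq^\flat A$, choose fairly $(g,a)\in F^*\times A$ with $a\in\mathrm{dom}\,g$ and set $A\leftarrow A\cup\{g^\infty(a)\}$; return $\mathrm{Max}\,A$. Fairness: writing $A_m$ for the value of $A$ after $m$ iterations, on every infinite execution every pair $(g,a)\in F^*\times A_m$ with $a\in\mathrm{dom}\,g$ is picked at some later iteration. -}

module Defs where

open import Level using (Level; _⊔_) renaming (zero to 0ℓ; suc to lsuc)
open import Data.Nat using (ℕ; zero; suc; _<_)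
open import Data.Fin using (Fin)
open import Data.List using (List; []; _∷_)
open import Data.List.Membership.Propositional using (_∈_)
open import Data.Maybe using (Maybe; just; nothing; _>>=_)
open import Data.Product using (Σ; ∃; ∃-syntax; _×_; _,_)
open import Relation.Nullary using (¬_)
open import Relation.Unary using (Pred; _⊆_)
open import Relation.Binary using (Rel; Decidable; IsPartialOrder)
open import Relation.Binary.PropositionalEquality using (_≡_; _≢_)
open import Relation.Binary.Construct.Closure.ReflexiveTransitive using (Star)
open import Function.Definitions using (Injective)

module Order {S : Set} (_≤_ : Rel S 0ℓ) where

  _<_ˢ : S → S → Set
  x < y ˢ = (x ≤ y) × (x ≢ y)

  Down : ∀ {ℓ} → Pred S ℓ → Pred S ℓ
  Down E x = ∃[ y ] (E y × x ≤ y)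

  Up : ∀ {ℓ} → Pred S ℓ → Pred S ℓ
  Up E x = ∃[ y ] (E y × y ≤ x)

  Max : ∀ {ℓ} → Pred S ℓ → Pred S ℓ
  Max E x = E x × (∀ y → E y → x ≤ y → x ≡ y)

  Directed : ∀ {ℓ} → Pred S ℓ → Set ℓ
  Directed D = (∃[ x ] D x) ×
               (∀ x y → D x → D y → ∃[ z ] (D z × x ≤ z × y ≤ z))

  IsLub : ∀ {ℓ} → Pred S ℓ → S → Set ℓ
  IsLub D x = (∀ y → D y → y ≤ x) × (∀ u → (∀ y → D y → y ≤ u) → x ≤ u)

  IsDcpo : Set₁
  IsDcpo = (D : Pred S 0ℓ) → Directed D → ∃[ x ] IsLub D x

  _≪_ : S → S → Set₁
  y ≪ x = (D : Pred S 0ℓ) → Directed D → (s : S) → IsLub D s → x ≤ s →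
          ∃[ z ] (D z × y ≤ z)

  IsContinuous : Set₁
  IsContinuous = ∀ x → Directed (λ y → y ≪ x) × IsLub (λ y → y ≪ x) x

  IsWpo : Set
  IsWpo = (f : ℕ → S) → ∃[ i ] ∃[ j ] (i < j × f i ≤ f j)

  ScottOpen : Pred S 0ℓ → Set₁
  ScottOpen U = (∀ x y → U x → x ≤ y → U y) ×
                ((D : Pred S 0ℓ) → Directed D → (s : S) → IsLub D s → U s →
                  ∃[ d ] (D d × U d))

  Lub : ∀ {ℓ} → Pred S ℓ → Pred S (lsuc 0ℓ ⊔ ℓ)
  Lub E x = Σ (Pred S 0ℓ) λ D → (D ⊆ E) × Directed D × IsLub D x

PMap : Set → Set
PMap S = S → Maybe S

module Partial {S : Set} (_≤_ : Rel S 0ℓ) where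
  open Order _≤_

  dom : PMap S → Pred S 0ℓ
  dom f x = ∃[ y ] (f x ≡ just y)

  Image : PMap S → Pred S 0ℓ → Pred S 0ℓ
  Image f D y = ∃[ d ] (D d × f d ≡ just y)

  IsPartialContinuous : PMap S → Set₁
  IsPartialContinuous f =
    ScottOpen (dom f) ×
    ((D : Pred S 0ℓ) → Directed D → D ⊆ dom f → (s : S) → IsLub D s →
      ∃[ y ] (f s ≡ just y × IsLub (Image f D) y))

  _then_ : PMap S → PMap S → PMap S
  (f then g) x = f x >>= g

  iter : PMap S → ℕ → PMap S
  iter g zero    x = just x
  iter g (suc n) x = iter g n x >>= g

  IsAccelAt : PMap S → S → S → Set
  IsAccelAt g x y = ∃[ gx ] (g x ≡ just gx ×
                      (x < gx ˢ → IsLub (λ z → ∃[ n ] (iter g n x ≡ just z)) y) ×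
                      (¬ (x < gx ˢ) → y ≡ gx))

record CompleteWSTS : Set₂ where
  field
    S   : Set
    _≤_ : Rel S 0ℓ
    isPartialOrder : IsPartialOrder _≡_ _≤_
  open Order _≤_ public
  open Partial _≤_ public
  field
    isDcpo       : IsDcpo
    isContinuous : IsContinuous
    isWpo        : IsWpo
    k   : ℕ
    F   : Fin k → PMap S
    F-continuous : ∀ i → IsPartialContinuous (F i)

  Word : Set
  Word = List (Fin k)

  ⟦_⟧ : Word → PMap S
  ⟦ [] ⟧     x = just x
  ⟦ i ∷ w ⟧  = F i then ⟦ w ⟧

  Post : ∀ {ℓ} → Pred S ℓ → Pred S ℓ
  Post A y = ∃[ i ] ∃[ a ] (A a × F i a ≡ just y)

  PostIter : ∀ {ℓ} → ℕ → Pred S ℓ → Pred S ℓ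
  PostIter zero    A = A
  PostIter (suc n) A = Post (PostIter n A)

  PostStar : ∀ {ℓ} → Pred S ℓ → Pred S ℓ
  PostStar A x = ∃[ n ] PostIter n A x

  Cover : S → Pred S 0ℓ
  Cover s0 = Down (PostStar (Down (_≡ s0)))

  Clover : S → Pred S (lsuc 0ℓ)
  Clover s0 = Max (Lub (Cover s0))

-- ∞-effectiveness.  Computability is witnessed by Agda functions
-- (every Agda function is computable); the domains of the F i are
-- decidable since F i : S → Maybe S.

record InfEffective (W : CompleteWSTS) : Set where
  open CompleteWSTS W
  field
    code        : S → ℕ
    code-inj    : Injective _≡_ _≡_ code
    _≤?_        : Decidable _≤_
    accel       : Word → PMap S
    accel-dom   : ∀ g x → ⟦ g ⟧ x ≡ nothing → accel g x ≡ nothing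
    accel-spec  : ∀ g x y → accel g x ≡ just y → IsAccelAt ⟦ g ⟧ x y
    accel-total : ∀ g x y → ⟦ g ⟧ x ≡ just y → ∃[ z ] (accel g x ≡ just z)

module Procedure (W : CompleteWSTS) (E : InfEffective W) where
  open CompleteWSTS W
  open InfEffective E

  _≤♭_ : ∀ {ℓ} → Pred S ℓ → List S → Set ℓ
  A ≤♭ B = Down A ⊆ Down (_∈ B)

  Stop : List S → Set
  Stop A = Post (_∈ A) ≤♭ A

  Step : List S → List S → Set
  Step A A' = ¬ Stop A ×
              ∃[ g ] ∃[ a ] ∃[ b ] (a ∈ A × dom ⟦ g ⟧ a × accel g a ≡ just b × A' ≡ b ∷ A)

  Run : List S → List S → Set
  Run = Star Step

  Terminates : S → List S → Set
  Terminates s0 A = Run (s0 ∷ []) A × Stop A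

  Returned : List S → Pred S 0ℓ
  Returned A = Max (_∈ A)

{-# OPTIONS --safe #-}

-- Every element the procedure adds lies in Lub (Cover s0), and on termination the
-- down-closure of A contains Cover s0, hence also Lub (Cover s0) because A is finite;
-- so A and Lub (Cover s0) have the same maximal elements.
--
-- The delicate point is that Lub C is closed under directed lubs for down-closed C.
-- Classically the witness is {y | y ≪ y′ ≪ b}, but _≪_ quantifies over all predicates
-- and so lives in Set₁.  However, in a continuous dcpo with decidable order a strict
-- pair u < x yields ¬ ¬ excluded middle for Set; under excluded middle predicates are
-- Boolean and _≪_ becomes small.  Being a lub is a ¬¬-stable property, so excluded
-- middle may be used to verify it.

module Submission where

open import Axiom.ExcludedMiddle using (ExcludedMiddle)
open import Data.Bool using (Bool; T)
open import Data.List using (List; []; _∷_)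
open import Data.List.Membership.Propositional using (_∈_; find)
open import Data.List.Relation.Unary.All as All using (All; []; _∷_)
open import Data.List.Relation.Unary.All.Properties using (¬Any⇒All¬)
open import Data.List.Relation.Unary.Any using (any?; here; there)
open import Data.Maybe using (just)
open import Data.Maybe.Properties using (just-injective)
open import Data.Nat as ℕ using (ℕ; zero; suc)
import Data.Nat.Properties as ℕ
open import Data.Product using (∃; ∃-syntax; _×_; _,_; proj₁; proj₂)
open import Data.Sum using (_⊎_; inj₁; inj₂)
open import Function using (_∘_)
open import Level using (0ℓ)
open import Relation.Binary using (Rel; Decidable; IsPartialOrder)
open import Relation.Binary.Construct.Closure.ReflexiveTransitive using (ε; _◅_)
open import Relation.Binary.PropositionalEquality using (_≡_; refl; sym; trans; subst)
open import Relation.Nullary using (¬_; Dec; yes; no; contradiction)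
open import Relation.Nullary.Decidable
  using (⌊_⌋; toWitness; fromWitness; decidable-stable)
open import Relation.Unary using (Pred; _⊆_)

open import Defs

-- Directed lubs over a decidable order.

module DecidableOrder {S : Set} {_≤_ : Rel S 0ℓ}
  (isPartialOrder : IsPartialOrder _≡_ _≤_) (_≤?_ : Decidable _≤_) where

  open Order _≤_
  open IsPartialOrder isPartialOrder using (reflexive)
    renaming (refl to ≤-refl; trans to ≤-trans)

  DownClosed : Pred S 0ℓ → Set
  DownClosed C = ∀ {x y} → x ≤ y → C y → C x

  singleton-directed : ∀ x → Directed (_≡ x)
  singleton-directed x = (x , refl) , λ { _ _ refl refl → x , refl , ≤-refl , ≤-refl }

  singleton-lub : ∀ x → IsLub (_≡ x) x
  singleton-lub x = (λ { _ refl → ≤-refl }) , (λ _ ub → ub x refl)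

  ⊆-Lub : ∀ {C : Pred S 0ℓ} → C ⊆ Lub C
  ⊆-Lub {x = x} c = (_≡ x) , (λ { refl → c }) , singleton-directed x , singleton-lub x

  Directed-resp : ∀ {ℓ ℓ′} {D : Pred S ℓ} {E : Pred S ℓ′} → D ⊆ E → E ⊆ D →
                  Directed D → Directed E
  Directed-resp to from ((x , d) , join) =
    (x , to d) , λ x y p q → let z , e , r = join x y (from p) (from q) in z , to e , r

  IsLub-resp : ∀ {ℓ ℓ′} {D : Pred S ℓ} {E : Pred S ℓ′} → D ⊆ E → E ⊆ D →
               ∀ {x} → IsLub D x → IsLub E x
  IsLub-resp to from (ub , least) =
    (λ y → ub y ∘ from) , λ u ubE → least u λ y → ubE y ∘ to

  -- Both halves end in an inequality, and decidable inequalities are stable.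
  IsLub-stable : ∀ {ℓ} {D : Pred S ℓ} {x} → ¬ ¬ IsLub D x → IsLub D x
  IsLub-stable ¬¬lub =
    (λ y d → decidable-stable (y ≤? _) λ ¬p → ¬¬lub λ (ub , _) → ¬p (ub y d)) ,
    (λ u ub → decidable-stable (_ ≤? u) λ ¬p → ¬¬lub λ (_ , least) → ¬p (least u ub))

  ≪⇒≤ : ∀ {x y} → y ≪ x → y ≤ x
  ≪⇒≤ {x} y≪x with y≪x (_≡ x) (singleton-directed x) x (singleton-lub x) ≤-refl
  ... | _ , refl , y≤x = y≤x

  ≪-≤-trans : ∀ {x y z} → y ≪ x → x ≤ z → y ≪ z
  ≪-≤-trans y≪x x≤z D dir s lub z≤s = y≪x D dir s lub (≤-trans x≤z z≤s)

  ≪⇒C : ∀ {C} → DownClosed C → ∀ {x y} → Lub C x → y ≪ x → C y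
  ≪⇒C closed (D , D⊆C , dir , lub) y≪x =
    let _ , d , y≤d = y≪x D dir _ lub ≤-refl in closed y≤d (D⊆C d)

  -- Induction on `A`. Let `e` in `D` escape the tail. If no member of `D` above `e` escaped `a` as
  -- well, directedness would put all of `D` below `a`, hence `s ≤ a`. The witness is obtained by
  -- contradiction only, hence the double negation.
  ¬¬escape : ∀ {ℓ} {D : Pred S ℓ} {s} → Directed D → IsLub D s →
             ∀ {A} → All (λ a → ¬ s ≤ a) A →
             ¬ ¬ (∃[ d ] (D d × All (λ a → ¬ d ≤ a) A))
  ¬¬escape ((x , d) , _) _ [] k = k (x , d , [])
  ¬¬escape dir@(_ , join) lub@(_ , least) (s≰a ∷ s≰A) k =
    ¬¬escape dir lub s≰A λ (e , De , e≰A) →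
      s≰a (least _ λ y Dy → decidable-stable (y ≤? _) λ y≰a →
        let z , Dz , y≤z , e≤z = join y e Dy De in
        k (z , Dz , (y≰a ∘ ≤-trans y≤z) ∷ All.map (λ e≰b → e≰b ∘ ≤-trans e≤z) e≰A))

  -- Whether `s` lies below a member of a list is decidable, so the doubly negated `¬¬escape` is
  -- needed only to refute the negative case.
  Lub-Down-finite : ∀ {C : Pred S 0ℓ} {A} → C ⊆ Down (_∈ A) → Lub C ⊆ Down (_∈ A)
  Lub-Down-finite {A = A} C⊆↓A {s} (D , D⊆C , dir , lub) with any? (s ≤?_) A
  ... | yes s≤A = find s≤A
  ... | no s≰A = contradiction
    (λ (d , Dd , d≰A) → let _ , a∈A , d≤a = C⊆↓A (D⊆C Dd) in All.lookup d≰A a∈A d≤a)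
    (¬¬escape dir lub (¬Any⇒All¬ A s≰A))

  -- Restricting the test sets to Boolean predicates keeps the relation in `Set`, so it may occur in
  -- the witness of a `Lub`.
  _≪ᵇ_ : S → S → Set
  y ≪ᵇ x = (D : S → Bool) → Directed (T ∘ D) → (s : S) → IsLub (T ∘ D) s → x ≤ s →
           ∃[ z ] (T (D z) × y ≤ z)

  ≪⇒≪ᵇ : ∀ {x y} → y ≪ x → y ≪ᵇ x
  ≪⇒≪ᵇ y≪x D = y≪x (T ∘ D)

  ≪ᵇ⇒≪ : ExcludedMiddle 0ℓ → ∀ {x y} → y ≪ᵇ x → y ≪ x
  ≪ᵇ⇒≪ em y≪x D dir s lub x≤s =
    let z , d , y≤z = y≪x (λ z → ⌊ em {D z} ⌋) (Directed-resp fromWitness toWitness dir)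
                          s (IsLub-resp fromWitness toWitness lub) x≤s
    in z , toWitness d , y≤z

  _≪ᵇ²_ : S → S → Set
  y ≪ᵇ² x = ∃[ y′ ] (y ≪ᵇ y′ × y′ ≪ᵇ x)

  -- Closure of `Lub C` under directed lubs.

  module ContinuousDcpo (isDcpo : IsDcpo) (isContinuous : IsContinuous) where

    -- The lub of {u} ∪ {x | P} decides P.
    ≪-strict⇒em : ∀ {u x y} → u ≤ x → ¬ x ≤ u → y ≪ x → ¬ y ≤ u → ExcludedMiddle 0ℓ
    ≪-strict⇒em {u} {x} {y} u≤x x≰u y≪x y≰u {P} = decide
      where
      D : Pred S 0ℓ
      D z = z ≡ u ⊎ (z ≡ x × P)

      directed : Directed D
      directed = (u , inj₁ refl) , λ where
        _ _ (inj₁ refl)       (inj₁ refl)       → u , inj₁ refl , ≤-refl , ≤-refl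
        _ _ (inj₁ refl)       (inj₂ (refl , p)) → x , inj₂ (refl , p) , u≤x , ≤-refl
        _ _ (inj₂ (refl , p)) (inj₁ refl)       → x , inj₂ (refl , p) , ≤-refl , u≤x
        _ _ (inj₂ (refl , p)) (inj₂ (refl , _)) → x , inj₂ (refl , p) , ≤-refl , ≤-refl

      decide : Dec P
      decide with isDcpo D directed
      ... | s , lub@(ub , least) with x ≤? s
      ...   | no x≰s = no λ p → x≰s (ub x (inj₂ (refl , p)))
      -- Some member of `D` lies above `y`. It cannot be `u`, so it is `x`, whose membership carries
      -- a proof of `P`.
      ...   | yes x≤s with y≪x D directed s lub x≤s
      ...     | _ , inj₁ refl , y≤u     = contradiction y≤u y≰u
      ...     | _ , inj₂ (refl , p) , _ = yes p

    -- Not every `y ≪ x` can lie below `u`, since `x` is the lub of these `y`.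
    strict⇒¬¬em : ∀ {u x} → u ≤ x → ¬ x ≤ u → ¬ ¬ ExcludedMiddle 0ℓ
    strict⇒¬¬em {u} {x} u≤x x≰u ¬em =
      x≰u (proj₂ (proj₂ (isContinuous x)) u λ y y≪x →
        decidable-stable (y ≤? u) λ y≰u → ¬em (≪-strict⇒em u≤x x≰u y≪x y≰u))

    ≪ᵇ²-directed : ExcludedMiddle 0ℓ → ∀ x → Directed (_≪ᵇ² x)
    ≪ᵇ²-directed em x =
      (let y , y≪x = proj₁ (proj₁ (isContinuous x))
           z , z≪y = proj₁ (proj₁ (isContinuous y))
       in z , y , ≪⇒≪ᵇ z≪y , ≪⇒≪ᵇ y≪x) ,
      λ v w (v′ , v≪v′ , v′≪x) (w′ , w≪w′ , w′≪x) →
        let t′ , t′≪x , v′≤t′ , w′≤t′ = proj₂ (proj₁ (isContinuous x)) v′ w′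
              (≪ᵇ⇒≪ em v′≪x) (≪ᵇ⇒≪ em w′≪x)
            t , t≪t′ , v≤t , w≤t = proj₂ (proj₁ (isContinuous t′)) v w
              (≪-≤-trans (≪ᵇ⇒≪ em v≪v′) v′≤t′) (≪-≤-trans (≪ᵇ⇒≪ em w≪w′) w′≤t′)
        in t , (t′ , ≪⇒≪ᵇ t≪t′ , ≪⇒≪ᵇ t′≪x) , v≤t , w≤t

    ≪ᵇ²-lub : ExcludedMiddle 0ℓ → ∀ x → IsLub (_≪ᵇ² x) x
    ≪ᵇ²-lub em x =
      (λ y (y′ , y≪y′ , y′≪x) → ≤-trans (≪⇒≤ (≪ᵇ⇒≪ em y≪y′)) (≪⇒≤ (≪ᵇ⇒≪ em y′≪x))) ,
      (λ u ub → proj₂ (proj₂ (isContinuous x)) u λ y y≪x →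
        proj₂ (proj₂ (isContinuous y)) u λ z z≪y →
          ub z (y , ≪⇒≪ᵇ z≪y , ≪⇒≪ᵇ y≪x))

    -- Directedness and inclusion in C need genuine witnesses, so the approximants of b
    -- are admitted to D only together with a proof that they are directed and lie in C.
    -- Such a proof exists under excluded middle, which is enough for D to have lub b.
    Lub-closed : ∀ {C} → DownClosed C → ¬ ¬ ExcludedMiddle 0ℓ →
                 ∀ {B : Pred S 0ℓ} {b} → Directed B → B ⊆ Lub C → IsLub B b → Lub C b
    Lub-closed {C} closed ¬¬em {B} {b} B-directed B⊆LubC B-lub =
      D , D⊆C , D-directed , IsLub-stable (λ ¬lub → ¬¬em (¬lub ∘ D-lub))
      where
      -- Two approximation steps are used: the outer one lands below some member of `B`, which is
      -- only in `Lub C`, and the inner one descends from there into `C`.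
      ≪≪⇒C : ∀ {y y′} → y ≪ y′ → y′ ≪ b → C y
      ≪≪⇒C y≪y′ y′≪b =
        let _ , β , y′≤β = y′≪b B B-directed b B-lub ≤-refl
        in ≪⇒C closed (B⊆LubC β) (≪-≤-trans y≪y′ y′≤β)

      -- Continuity at `b` and then at `y₀` yields a seed `y₁`, so that `D` is inhabited without
      -- excluded middle.
      y₀ : ∃[ y ] y ≪ b
      y₀ = proj₁ (proj₁ (isContinuous b))

      y₁ : ∃[ y ] y ≪ proj₁ y₀
      y₁ = proj₁ (proj₁ (isContinuous (proj₁ y₀)))

      y₁≪ᵇ²b : proj₁ y₁ ≪ᵇ² b
      y₁≪ᵇ²b = proj₁ y₀ , ≪⇒≪ᵇ (proj₂ y₁) , ≪⇒≪ᵇ (proj₂ y₀)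

      Good : Set
      Good = Directed (_≪ᵇ² b) × ((_≪ᵇ² b) ⊆ C)

      D : Pred S 0ℓ
      D y = y ≡ proj₁ y₁ ⊎ (Good × y ≪ᵇ² b)

      D⊆C : D ⊆ C
      D⊆C (inj₁ refl)             = ≪≪⇒C (proj₂ y₁) (proj₂ y₀)
      D⊆C (inj₂ ((_ , ⊆C) , y≪b)) = ⊆C y≪b

      D⇒≪ᵇ² : D ⊆ (_≪ᵇ² b)
      D⇒≪ᵇ² (inj₁ refl)      = y₁≪ᵇ²b
      D⇒≪ᵇ² (inj₂ (_ , y≪b)) = y≪b

      join : Good → ∀ x y → x ≪ᵇ² b → y ≪ᵇ² b → ∃[ z ] (D z × x ≤ z × y ≤ z)
      join good@((_ , j) , _) x y p q = let z , r , x≤z , y≤z = j x y p q in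
        z , inj₂ (good , r) , x≤z , y≤z

      -- Either both elements are the seed, or one of them carries a proof of `Good`, which supplies
      -- the join.
      D-directed : Directed D
      D-directed = (proj₁ y₁ , inj₁ refl) , λ where
        _ _ (inj₁ refl) (inj₁ refl)         → proj₁ y₁ , inj₁ refl , ≤-refl , ≤-refl
        x y p@(inj₁ _) (inj₂ (good , q))    → join good x y (D⇒≪ᵇ² p) q
        x y (inj₂ (good , p)) q             → join good x y p (D⇒≪ᵇ² q)

      D-lub : ExcludedMiddle 0ℓ → IsLub D b
      D-lub em = IsLub-resp (λ y≪b → inj₂ (good , y≪b)) D⇒≪ᵇ² (≪ᵇ²-lub em b)
        where
        good : Good
        good = ≪ᵇ²-directed em b ,
               λ (_ , y≪y′ , y′≪b) → ≪≪⇒C (≪ᵇ⇒≪ em y≪y′) (≪ᵇ⇒≪ em y′≪b)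

  -- Partial continuous maps.

  open Partial _≤_

  Monotone : PMap S → Set
  Monotone f = ∀ {x x′ y} → x ≤ x′ → f x ≡ just y → ∃[ y′ ] (f x′ ≡ just y′ × y ≤ y′)

  -- Continuity is applied to the directed pair of `x` and `x′`, whose lub is `x′`; it lies in the
  -- domain because that is upward closed.
  continuous⇒monotone : ∀ {f} → IsPartialContinuous f → Monotone f
  continuous⇒monotone {f} ((up , _) , preserves) {x} {x′} {y} x≤x′ fx =
    let y′ , fx′ , ub , _ = preserves D directed D⊆dom x′ lub
    in y′ , fx′ , ub y (x , inj₁ refl , fx)
    where
    D : Pred S 0ℓ
    D z = z ≡ x ⊎ z ≡ x′

    ub : ∀ y → D y → y ≤ x′
    ub _ (inj₁ refl) = x≤x′
    ub _ (inj₂ refl) = ≤-refl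

    directed : Directed D
    directed = (x , inj₁ refl) , λ v w p q → x′ , inj₂ refl , ub v p , ub w q

    lub : IsLub D x′
    lub = ub , λ _ ub → ub x′ (inj₂ refl)

    D⊆dom : D ⊆ dom f
    D⊆dom (inj₁ refl) = y , fx
    D⊆dom (inj₂ refl) = up x x′ (y , fx) x≤x′

  -- `D` may leave the domain of `f`, so it is cut down to `D′`. Scott-openness makes `D′` inhabited
  -- and cofinal in `D`, which preserves the lub.
  continuous-Lub : ∀ {f} → IsPartialContinuous f → ∀ {C : Pred S 0ℓ} →
                   (∀ {x y} → C x → f x ≡ just y → C y) →
                   ∀ {x y} → Lub C x → f x ≡ just y → Lub C y
  continuous-Lub {f} f-cont@((up , open′) , preserves) f-closed {x} {y}
    (D , D⊆C , dir , lub) fx =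
    Image f D′ , (λ (_ , (d , _) , e) → f-closed (D⊆C d) e) , Image-directed ,
    Image-lub (preserves D′ D′-directed proj₂ x D′-lub)
    where
    D′ : Pred S 0ℓ
    D′ z = D z × dom f z

    d₀ : ∃ D′
    d₀ = open′ D dir x lub (y , fx)

    D′-directed : Directed D′
    D′-directed = d₀ , λ v w (p , def) (q , _) →
      let z , r , v≤z , w≤z = proj₂ dir v w p q in z , (r , up v z def v≤z) , v≤z , w≤z

    D′-lub : IsLub D′ x
    D′-lub = (λ z (d , _) → proj₁ lub z d) , λ u ub → proj₂ lub u λ z d →
      let e , p , def = d₀
          t , r , z≤t , e≤t = proj₂ dir z e d p
      in ≤-trans z≤t (ub t (r , up e t def e≤t))

    Image-directed : Directed (Image f D′)
    Image-directed =
      (let d , p , (fd , eq) = d₀ in fd , d , (p , fd , eq) , eq) ,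
      λ v w (c , p , fc) (d , q , fd) →
        let z , r , c≤z , d≤z = proj₂ D′-directed c d p q
            v′ , fz , v≤v′ = continuous⇒monotone f-cont c≤z fc
            w′ , fz′ , w≤w′ = continuous⇒monotone f-cont d≤z fd
        in v′ , (z , r , fz) , v≤v′ ,
           ≤-trans w≤w′ (reflexive (just-injective (trans (sym fz′) fz)))

    Image-lub : ∃[ y′ ] (f x ≡ just y′ × IsLub (Image f D′) y′) → IsLub (Image f D′) y
    Image-lub (_ , fx′ , l) with just-injective (trans (sym fx) fx′)
    ... | refl = l

  -- Orbits of a monotone partial map.

  module Iteration {g : PMap S} (g-mono : Monotone g)
    {x gx : S} (g-def : g x ≡ just gx) (x≤gx : x ≤ gx) where

    Orbit : Pred S 0ℓ
    Orbit z = ∃[ n ] (iter g n x ≡ just z)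

    -- Monotonicity propagates `x ≤ gx` along the orbit. As `Monotone` also asserts definedness at
    -- larger arguments, the orbit never leaves the domain.
    iter-step : ∀ n {z} → iter g n x ≡ just z → ∃[ z′ ] (iter g (suc n) x ≡ just z′ × z ≤ z′)
    iter-step zero    refl = gx , g-def , x≤gx
    iter-step (suc n) eq with iter g n x in eqₙ
    ... | just z₀ with iter-step n eqₙ
    ...   | z₁ , eq₁ , z₀≤z₁ rewrite eqₙ | just-injective (trans (sym eq) eq₁) | eq₁ =
      g-mono z₀≤z₁ eq₁

    iter-mono : ∀ {m n} → m ℕ.≤′ n → ∀ {z} → iter g m x ≡ just z →
                ∃[ z′ ] (iter g n x ≡ just z′ × z ≤ z′)
    iter-mono ℕ.≤′-refl eq = _ , eq , ≤-refl
    iter-mono (ℕ.≤′-step {n} m≤n) eq =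
      let _ , eq′ , p = iter-mono m≤n eq
          z , eq″ , q = iter-step n eq′
      in z , eq″ , ≤-trans p q

    Orbit-directed : Directed Orbit
    Orbit-directed = (x , 0 , refl) , join
      where
      join : ∀ v w → Orbit v → Orbit w → ∃[ z ] (Orbit z × v ≤ z × w ≤ z)
      join v w (m , p) (n , q) with ℕ.≤-total m n
      ... | inj₁ m≤n = let _ , p′ , v≤w = iter-mono (ℕ.≤⇒≤′ m≤n) p in
        w , (n , q) , subst (v ≤_) (just-injective (trans (sym p′) q)) v≤w , ≤-refl
      ... | inj₂ n≤m = let _ , q′ , w≤v = iter-mono (ℕ.≤⇒≤′ n≤m) q in
        v , (m , p) , ≤-refl , subst (w ≤_) (just-injective (trans (sym q′) p)) w≤v

    iter-closed : ∀ {ℓ} {L : Pred S ℓ} → (∀ {x y} → L x → g x ≡ just y → L y) → L x →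
                  ∀ n {z} → iter g n x ≡ just z → L z
    iter-closed closed l zero    refl = l
    iter-closed closed l (suc n) eq with iter g n x in eqₙ
    ... | just _ = closed (iter-closed closed l n eqₙ) eq

-- Invariants of the procedure.

module Correctness (W : CompleteWSTS) (E : InfEffective W) where

  open CompleteWSTS W
  open InfEffective E
  open Procedure W E
  open IsPartialOrder isPartialOrder using (antisym)
    renaming (refl to ≤-refl; trans to ≤-trans)
  open DecidableOrder isPartialOrder _≤?_
  open ContinuousDcpo isDcpo isContinuous

  F-monotone : ∀ i → Monotone (F i)
  F-monotone i = continuous⇒monotone (F-continuous i)

  word-monotone : ∀ w → Monotone ⟦ w ⟧
  word-monotone []      x≤x′ refl = _ , refl , x≤x′
  word-monotone (i ∷ w) {x} x≤x′ eq with F i x in eqᵢ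
  ... | just _ with F-monotone i x≤x′ eqᵢ
  ...   | _ , eqᵢ′ , y≤y′ rewrite eqᵢ′ = word-monotone w y≤y′ eq

  word-closed : ∀ {ℓ} {L : Pred S ℓ} → (∀ i {x y} → L x → F i x ≡ just y → L y) →
                ∀ w {x y} → L x → ⟦ w ⟧ x ≡ just y → L y
  word-closed closed []      l refl = l
  word-closed closed (i ∷ w) {x} l eq with F i x in eqᵢ
  ... | just _ = word-closed closed w (closed i l eqᵢ) eq

  module _ (s0 : S) where

    Cover-down : DownClosed (Cover s0)
    Cover-down x≤y (z , p , y≤z) = z , p , ≤-trans x≤y y≤z

    Cover-F : ∀ i {x y} → Cover s0 x → F i x ≡ just y → Cover s0 y
    Cover-F i (z , (n , p) , x≤z) fx =
      let z′ , fz , y≤z′ = F-monotone i x≤z fx in z′ , (suc n , i , z , p , fz) , y≤z′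

    s0∈Cover : Cover s0 s0
    s0∈Cover = s0 , (0 , s0 , refl , ≤-refl) , ≤-refl

    LubCover-word : ∀ w {x y} → Lub (Cover s0) x → ⟦ w ⟧ x ≡ just y → Lub (Cover s0) y
    LubCover-word = word-closed λ i → continuous-Lub (F-continuous i) (Cover-F i)

    -- If `a < ga`, then `b` is the lub of a directed orbit inside `Lub (Cover s0)`, and this same
    -- strict pair supplies the excluded middle that `Lub-closed` asks for. Otherwise `b` is `ga`.
    LubCover-accel : ∀ g {a b} → Lub (Cover s0) a → accel g a ≡ just b → Lub (Cover s0) b
    LubCover-accel g {a} {b} a∈L eq with accel-spec g a b eq
    ... | ga , g-def , <-case , ≮-case with a ≤? ga | ga ≤? a
    ... | yes a≤ga | no ga≰a =
      Lub-closed Cover-down (strict⇒¬¬em a≤ga ga≰a) Orbit-directed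
        (λ (n , eqₙ) → iter-closed (LubCover-word g) a∈L n eqₙ)
        (<-case (a≤ga , λ { refl → ga≰a ≤-refl }))
      where open Iteration (word-monotone g) g-def a≤ga
    ... | no a≰ga | _ =
      subst (Lub (Cover s0)) (sym (≮-case (a≰ga ∘ proj₁))) (LubCover-word g a∈L g-def)
    ... | yes a≤ga | yes ga≤a =
      subst (Lub (Cover s0)) (sym (≮-case λ (_ , a≢ga) → a≢ga (antisym a≤ga ga≤a)))
        (LubCover-word g a∈L g-def)

    run-sound : ∀ {A B} → Run A B → (_∈ A) ⊆ Lub (Cover s0) → (_∈ B) ⊆ Lub (Cover s0)
    run-sound ε inv = inv
    run-sound ((_ , g , a , b , a∈A , _ , eq , refl) ◅ run) inv = run-sound run λ where
      (here refl) → LubCover-accel g (inv a∈A) eq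
      (there x∈A) → inv x∈A

    run-⊇ : ∀ {A B} → Run A B → (_∈ A) ⊆ (_∈ B)
    run-⊇ ε x∈A = x∈A
    run-⊇ ((_ , _ , _ , _ , _ , _ , _ , refl) ◅ run) x∈A = run-⊇ run (there x∈A)

    -- Induction on the number of `Post` steps: monotonicity moves a step to a member of `A` above
    -- its source, and `stop` brings the result back below `A`.
    Cover⊆Down : ∀ {A} → s0 ∈ A → Stop A → Cover s0 ⊆ Down (_∈ A)
    Cover⊆Down {A} s0∈A stop (z , (n , p) , x≤z) =
      let a , a∈A , z≤a = reach n p in a , a∈A , ≤-trans x≤z z≤a
      where
      reach : ∀ n → PostIter n (Down (_≡ s0)) ⊆ Down (_∈ A)
      reach zero    (_ , refl , x≤s0) = s0 , s0∈A , x≤s0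
      reach (suc n) (i , x , p , fx) =
        let a , a∈A , x≤a = reach n p
            y′ , fa , y≤y′ = F-monotone i x≤a fx
        in stop (y′ , (i , a , a∈A , fa) , y≤y′)

theorem5p5 : (W : CompleteWSTS) (E : InfEffective W) →
    let open CompleteWSTS W
        open Procedure W E
    in (s0 : S) (A : List S) → Terminates s0 A →
       (∀ x → Returned A x → Clover s0 x) × (∀ x → Clover s0 x → Returned A x)
theorem5p5 W E s0 A (run , stop) =
  (λ x (x∈A , x-max) → A⊆L x∈A , λ y y∈L x≤y →
    let a , a∈A , y≤a = L⊆↓A y∈L
    in antisym x≤y (subst (y ≤_) (sym (x-max a a∈A (≤-trans x≤y y≤a))) y≤a)) ,
  -- Some member of `A` lies above `x`; maximality identifies the two, which is how `x` gets into
  -- `A`.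
  (λ x (x∈L , x-max) →
    let a , a∈A , x≤a = L⊆↓A x∈L
    in subst (_∈ A) (sym (x-max a (A⊆L a∈A) x≤a)) a∈A , λ y y∈A → x-max y (A⊆L y∈A))
  where
  open CompleteWSTS W
  open InfEffective E
  open Correctness W E
  open DecidableOrder isPartialOrder _≤?_
  open IsPartialOrder isPartialOrder using (antisym) renaming (trans to ≤-trans)

  A⊆L : (_∈ A) ⊆ Lub (Cover s0)
  A⊆L = run-sound s0 run λ { (here refl) → ⊆-Lub {C = Cover s0} (s0∈Cover s0) }

  L⊆↓A : Lub (Cover s0) ⊆ Down (_∈ A)
  L⊆↓A = Lub-Down-finite (Cover⊆Down s0 (run-⊇ s0 run (here refl)) stop)
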